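{- Let $n_1,n_2$ be positive integers, and let $x^1\in\mathbb{R}^{n_1}$ and $x^2\in\mathbb{R}^{n_2}$ be vectors of variables with no components in common. Let $P_1=\{x^1\in\mathbb{R}^{n_1}: A_1x^1\le a_1\}$ and $P_2=\{x^2\in\mathbb{R}^{n_2}: A_2x^2\le a_2\}$ be any non-empty polytopes, where $A_1\in\mathbb{R}^{p_1\times n_1}$, $a_1\in\mathbb{R}^{p_1}$, $A_2\in\mathbb{R}^{p_2\times n_2}$, $a_2\in\mathbb{R}^{p_2}$. Then the inequality description of $P_1$ can be augmented, by adding redundant variables and constraints, into an extended formulation of $P_2$; and, vice versa, the inequality description of $P_2$ can be augmented, by adding redundant variables and constraints, into an extended formulation of $P_1$. Here "extended formulation" may be taken in the sense of any of the definitions (D1), (D2), (D3).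
   Context: A polytope is a bounded set of the form $\{x: Ax\le a\}$ with finitely many inequalities. Extended formulations. Let $X\subseteq\mathbb{R}^p$ be a polytope and let $U=\{(x,w)\in\mathbb{R}^{p+q}: Gx+Hw\le g\}$ be a polyhedron, with $G\in\mathbb{R}^{m\times p}$, $H\in\mathbb{R}^{m\times q}$, $g\in\mathbb{R}^m$. (Equality constraints are allowed, since each can be written as a pair of inequalities.) (D1) $U$ is an extended formulation of $X$ if $\varphi_x(U)=X$, where $\varphi_x(U):=\{x\in\mathbb{R}^p: \exists w\in\mathbb{R}^q,\ (x,w)\in U\}$ is the projection of $U$ onto $x$-space. (D2) $U$ is an extended formulation of $X$ if there exists a linear map $\pi:\mathbb{R}^{p+q}\to\mathbb{R}^p$ such that $X=\pi(U)$. (D3) $U$ is an extended formulation of $X$ if for every $x\in\mathbb{R}^p$: $x\in X$ if and only if there exists $w\in\mathbb{R}^q$ with $(x,w)\in U$. When $U$ is described in several groups of variables, one of which is $x$, the remaining variables together play the role of $w$. Augmentation. Let $P=\{y\in\mathbb{R}^n: Ay\le a\}$. To augment the inequality description of $P$ by redundant variables and constraints means to pass to a system of finitely many linear inequalities in variables $(y,v)\in\mathbb{R}^n\times\mathbb{R}^k$, for some integer $k\ge 0$, such that the system contains the constraints $Ay\le a$ (possibly with each inequality multiplied by a positive scalar), and the added variables $v$ and the added constraints are redundant for $P$: for every $y\in P$ there exists $v\in\mathbb{R}^k$ such that $(y,v)$ satisfies all the constraints of the system (so the projection of the augmented system onto $y$-space is exactly $P$). -}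

module Defs where

open import Level using (Level; _⊔_; suc)
open import Algebra.Apartness.Bundles using (HeytingField)
open import Algebra.Bundles using (CommutativeRing)
import Algebra.Definitions.RawMonoid as RawMonoidDefinitions
import Algebra.Properties.Semiring.Sum as SemiringSum
open import Algebra.Module.Bundles.Raw using (RawLeftModule)
open import Algebra.Module.Morphism.Structures using (module LeftModuleMorphisms)
open import Data.Fin.Base using (Fin)
open import Data.Nat.Base as ℕ using (ℕ)
open import Data.Product.Base using (Σ; ∃; ∃-syntax; _×_)
open import Data.Sum.Base using (_⊎_)
open import Data.Vec.Functional using (Vector; _++_; take; drop; map; zipWith; replicate)
open import Data.Vec.Functional.Relation.Binary.Pointwise using (Pointwise)
open import Function.Bundles using (_⇔_)
open import Relation.Binary.Core using (Rel)
open import Relation.Binary.Structures using (IsStrictPartialOrder)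
open import Relation.Nullary.Negation using (¬_)
open import Relation.Unary using (Pred; _∈_; _≐_)

-- The field of real numbers, given axiomatically as a Cauchy complete
-- Archimedean ordered field.  Assuming excluded middle these axioms determine ℝ
-- up to unique isomorphism.  They are phrased with apartness and a strict order,
-- rather than a decidable total order and suprema, because in that form they
-- also hold of the constructive (Cauchy) reals.
record RealNumbers (c ℓ₁ ℓ₂ : Level) : Set (suc (c ⊔ ℓ₁ ⊔ ℓ₂)) where
  infix 4 _<_ _≤_
  field
    heytingField : HeytingField c ℓ₁ ℓ₂

  open HeytingField heytingField public
    using (Carrier; _≈_; _#_; _+_; _*_; -_; _-_; 0#; 1#; heytingCommutativeRing)

  commutativeRing : CommutativeRing c ℓ₁
  commutativeRing =
    record { isCommutativeRing = HeytingField.isCommutativeRing heytingField }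

  open CommutativeRing commutativeRing public using (semiring; +-rawMonoid)
  open RawMonoidDefinitions +-rawMonoid using () renaming (_×_ to _·1×_)

  field
    _<_                  : Rel Carrier ℓ₂
    isStrictPartialOrder : IsStrictPartialOrder _≈_ _<_
    #⇔<⊎>                : ∀ {x y} → (x # y) ⇔ (x < y ⊎ y < x)
    +-monoˡ-<            : ∀ {x y} z → x < y → x + z < y + z
    *-pos                : ∀ {x y} → 0# < x → 0# < y → 0# < x * y

  _≤_ : Rel Carrier ℓ₂
  x ≤ y = ¬ (y < x)

  -- As m and n range independently over the same tail, the one-sided bound
  -- controls the absolute value of the difference.
  IsCauchy : (ℕ → Carrier) → Set (c ⊔ ℓ₂)
  IsCauchy s = ∀ ε → 0# < ε →
    ∃[ N ] (∀ m n → N ℕ.≤ m → N ℕ.≤ n → s m - s n < ε)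

  _ConvergesTo_ : (ℕ → Carrier) → Carrier → Set (c ⊔ ℓ₂)
  s ConvergesTo l = ∀ ε → 0# < ε →
    ∃[ N ] (∀ n → N ℕ.≤ n → (s n - l < ε) × (l - s n < ε))

  field
    archimedean : ∀ x → ∃[ n ] (x < n ·1× 1#)
    complete    : ∀ s → IsCauchy s → ∃[ l ] (s ConvergesTo l)

data Sense : Set where
  projection linearImage membership : Sense

module Polyhedra {c ℓ₁ ℓ₂} (ℝ : RealNumbers c ℓ₁ ℓ₂) where
  open RealNumbers ℝ
  open SemiringSum semiring using (sum)

  infixl 7 _·_
  infixl 6 _+ᵛ_
  infix  4 _≤ᵛ_ _≈ᵛ_

  Matrix : ℕ → ℕ → Set c
  Matrix m n = Vector (Vector Carrier n) m

  _≤ᵛ_ : ∀ {n} → Rel (Vector Carrier n) ℓ₂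
  _≤ᵛ_ = Pointwise _≤_

  _≈ᵛ_ : ∀ {n} → Rel (Vector Carrier n) ℓ₁
  _≈ᵛ_ = Pointwise _≈_

  _+ᵛ_ : ∀ {n} → Vector Carrier n → Vector Carrier n → Vector Carrier n
  _+ᵛ_ = zipWith _+_

  _·_ : ∀ {m n} → Matrix m n → Vector Carrier n → Vector Carrier m
  (A · x) i = sum (λ j → A i j * x j)

  vectorRawLeftModule : ℕ → RawLeftModule Carrier c ℓ₁
  vectorRawLeftModule n = record
    { Carrierᴹ = Vector Carrier n
    ; _≈ᴹ_     = _≈ᵛ_
    ; _+ᴹ_     = _+ᵛ_
    ; _*ₗ_     = λ r → map (r *_)
    ; 0ᴹ       = replicate n 0#
    ; -ᴹ_      = map (-_)
    }

  IsLinear : ∀ {m n} → (Vector Carrier m → Vector Carrier n) → Set (c ⊔ ℓ₁)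
  IsLinear {m} {n} = IsLeftModuleHomomorphism
    where open LeftModuleMorphisms (vectorRawLeftModule m) (vectorRawLeftModule n)

  Polyhedron : ∀ {m n} → Matrix m n → Vector Carrier m → Pred (Vector Carrier n) ℓ₂
  Polyhedron A a x = A · x ≤ᵛ a

  IsBounded : ∀ {n ℓ} → Pred (Vector Carrier n) ℓ → Set (c ⊔ ℓ₂ ⊔ ℓ)
  IsBounded {n} X = ∃[ B ] (∀ x → x ∈ X → ∀ (i : Fin n) → (- B ≤ x i) × (x i ≤ B))

  -- A system G x + H w ≤ g in the variables (x , w).
  record System (p q : ℕ) : Set c where
    field
      {m} : ℕ
      G   : Matrix m p
      H   : Matrix m q
      g   : Vector Carrier m

  Solutions : ∀ {p q} → System p q → Pred (Vector Carrier (p ℕ.+ q)) ℓ₂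
  Solutions {p} S z = G · take p z +ᵛ H · drop p z ≤ᵛ g
    where open System S

  Projection : ∀ {p q ℓ} → Pred (Vector Carrier (p ℕ.+ q)) ℓ → Pred (Vector Carrier p) (c ⊔ ℓ)
  Projection {q = q} U x = Σ (Vector Carrier q) λ w → (x ++ w) ∈ U

  Image : ∀ {m n ℓ} → (Vector Carrier m → Vector Carrier n) →
          Pred (Vector Carrier m) ℓ → Pred (Vector Carrier n) (c ⊔ ℓ₁ ⊔ ℓ)
  Image π U x = ∃[ z ] (z ∈ U × π z ≈ᵛ x)

  -- U = Solutions S is an extended formulation of X in each of three senses: its
  -- projection onto x-space is X; it has X as its image under some linear map; a
  -- point x is in X exactly when some w completes it to a point of U.
  data IsExtendedFormulation {p q} (S : System p q) (X : Pred (Vector Carrier p) ℓ₂) :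
       Sense → Set (c ⊔ ℓ₁ ⊔ ℓ₂) where
    byProjection  : Projection {p} {q} (Solutions S) ≐ X →
                    IsExtendedFormulation S X projection
    byLinearImage : (π : Vector Carrier (p ℕ.+ q) → Vector Carrier p) → IsLinear π →
                    X ≐ Image π (Solutions S) →
                    IsExtendedFormulation S X linearImage
    byMembership  : (∀ x → x ∈ X ⇔ (Σ (Vector Carrier q) λ w → (x ++ w) ∈ Solutions S)) →
                    IsExtendedFormulation S X membership

  -- The system S in the variables (y , v) contains every inequality of A y ≤ a up
  -- to a positive factor, and every y with A y ≤ a extends to a solution of S.
  record IsAugmentation {p n k} (A : Matrix p n) (a : Vector Carrier p)
                        (S : System n k) : Set (c ⊔ ℓ₁ ⊔ ℓ₂) where
    open System S
    field
      contains  : ∀ i → ∃[ j ] ∃[ t ] (0# < t ×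
                    G j ≈ᵛ map (t *_) (A i) × H j ≈ᵛ replicate k 0# × g j ≈ t * a i)
      redundant : ∀ y → y ∈ Polyhedron A a →
                    Σ (Vector Carrier k) λ v → (y ++ v) ∈ Solutions S

  -- A system B y + C x + D u ≤ g in three groups of variables.
  record GroupedSystem (n n′ q : ℕ) : Set c where
    field
      {m} : ℕ
      B   : Matrix m n
      C   : Matrix m n′
      D   : Matrix m q
      g   : Vector Carrier m

    -- y against (x , u)
    firstGroup : System n (n′ ℕ.+ q)
    firstGroup = record { G = B ; H = λ i → C i ++ D i ; g = g }

    -- x against (y , u)
    secondGroup : System n′ (n ℕ.+ q)
    secondGroup = record { G = C ; H = λ i → B i ++ D i ; g = g }

  -- Since the variables x of X are not among the variables y of A y ≤ a, they
  -- belong to the added variables v = (x , u); for the extended formulation of X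
  -- the remaining variables are then (y , u).
  AugmentableInto : Sense → ∀ {p n n′} → Matrix p n → Vector Carrier p →
                    Pred (Vector Carrier n′) ℓ₂ → Set (c ⊔ ℓ₁ ⊔ ℓ₂)
  AugmentableInto d {n = n} {n′} A a X =
    ∃[ q ] Σ (GroupedSystem n n′ q) λ S →
      IsAugmentation A a (GroupedSystem.firstGroup S) ×
      IsExtendedFormulation (GroupedSystem.secondGroup S) X d

{-# OPTIONS --safe #-}

-- Put the two systems A₁ y ≤ a₁ and A₂ x ≤ a₂ side by side.  The result describes
-- P₁ × P₂, and since both factors are inhabited it projects onto each of them.

module Submission where

open import Defs
open import Algebra.Bundles using (CommutativeRing)
open import Data.Fin.Base as Fin using (_↑ˡ_; _↑ʳ_; splitAt)
open import Data.Nat.Base as ℕ using (ℕ; NonZero; zero; suc)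
open import Data.Product.Base using (Σ; _×_; _,_; proj₁; proj₂)
open import Data.Sum.Base using (inj₁; inj₂)
open import Data.Vec.Functional using (Vector; _++_; take; drop; replicate)
open import Data.Vec.Functional.Properties using (lookup-++ˡ; lookup-++ʳ)
open import Function.Base using (_∘_)
open import Function.Bundles using (mk⇔; module Equivalence)
open import Relation.Binary.PropositionalEquality as ≡ using ()
open import Relation.Binary.Structures using (IsStrictPartialOrder)
open import Relation.Unary using (Satisfiable; Pred; _∈_)
import Algebra.Apartness.Properties.HeytingCommutativeRing as HeytingProperties
import Algebra.Properties.Ring as RingProperties
import Algebra.Properties.Semiring.Sum as SemiringSum
import Relation.Binary.Reasoning.Setoid as SetoidReasoning

-- The constraints of the two polytopes share no variables, so the block-diagonal system
-- `A₁ y ≤ a₁`, `A₂ x ≤ a₂` has solution set P₁ × P₂ (`feasible⁺`, `feasible⁻`). One fixed point of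
-- P₂ extends every `y` in P₁ to a solution, so everything added to `A₁ y ≤ a₁` is redundant; one
-- fixed point of P₁ likewise completes every `x` in P₂, so the `x`-coordinates of the solutions
-- sweep out exactly P₂. `isExtendedFormulation` turns this last fact into each of the three senses.
-- Exchanging the two polytopes gives the converse direction.

module _ {c ℓ₁ ℓ₂} (ℝ : RealNumbers c ℓ₁ ℓ₂) where
  open RealNumbers ℝ hiding (_≈_; _+_; _*_; -_; _-_; 0#; 1#; Carrier; semiring; +-rawMonoid)
  open CommutativeRing commutativeRing hiding (zero)
  open SemiringSum semiring using (sum; sum-cong-≋; sum-replicate-zero)
  open RingProperties ring using (-1*x≈-x; -‿involutive)
  open HeytingProperties heytingCommutativeRing using (1#0)
  open IsStrictPartialOrder isStrictPartialOrder using (<-resp-≈)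
  open SetoidReasoning setoid
  open Polyhedra ℝ

  <-cong : ∀ {x x′ y y′} → x ≈ x′ → y ≈ y′ → x < y → x′ < y′
  <-cong x≈x′ y≈y′ = proj₂ <-resp-≈ x≈x′ ∘ proj₁ <-resp-≈ y≈y′

  ≤-cong : ∀ {x x′ y y′} → x ≈ x′ → y ≈ y′ → x ≤ y → x′ ≤ y′
  ≤-cong x≈x′ y≈y′ x≤y = x≤y ∘ <-cong (sym y≈y′) (sym x≈x′)

  -- Apartness of 1 and 0 leaves two orders; if 1 were negative, then -1 would be positive, and so
  -- would its square, which is 1. This makes 1 an admissible row multiplier in `contains`.
  0<1 : 0# < 1#
  0<1 with Equivalence.to #⇔<⊎> 1#0
  ... | inj₂ 0<1 = 0<1
  ... | inj₁ 1<0 = <-cong refl -1*-1≈1 (*-pos 0<-1 0<-1)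
    where
    0<-1 : 0# < - 1#
    0<-1 = <-cong (-‿inverseʳ 1#) (+-identityˡ (- 1#)) (+-monoˡ-< (- 1#) 1<0)

    -1*-1≈1 : - 1# * - 1# ≈ 1#
    -1*-1≈1 = trans (-1*x≈-x (- 1#)) (-‿involutive 1#)

  dot : ∀ {n} → Vector Carrier n → Vector Carrier n → Carrier
  dot u x = sum (λ j → u j * x j)

  dot-cong : ∀ {n} {u u′ x x′ : Vector Carrier n} → u ≈ᵛ u′ → x ≈ᵛ x′ → dot u x ≈ dot u′ x′
  dot-cong u≈u′ x≈x′ = sum-cong-≋ (λ j → *-cong (u≈u′ j) (x≈x′ j))

  dot-zeroˡ : ∀ {n} (x : Vector Carrier n) → dot (replicate n 0#) x ≈ 0#
  dot-zeroˡ {n} x = trans (sum-cong-≋ (λ j → zeroˡ (x j))) (sum-replicate-zero n)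

  sum-take-drop : ∀ m {n} (t : Vector Carrier (m ℕ.+ n)) → sum t ≈ sum (take m t) + sum (drop m t)
  sum-take-drop zero    t = sym (+-identityˡ _)
  sum-take-drop (suc m) t =
    trans (+-congˡ (sum-take-drop m (t ∘ Fin.suc))) (sym (+-assoc _ _ _))

  take-++ : ∀ {m n} (x : Vector Carrier m) (w : Vector Carrier n) → take m (x ++ w) ≈ᵛ x
  take-++ x w i = reflexive (lookup-++ˡ x w i)

  drop-++ : ∀ {m n} (x : Vector Carrier m) (w : Vector Carrier n) → drop m (x ++ w) ≈ᵛ w
  drop-++ x w i = reflexive (lookup-++ʳ x w i)

  dot-++ : ∀ {m n} (u : Vector Carrier m) (v : Vector Carrier n) (z : Vector Carrier (m ℕ.+ n)) →
           dot (u ++ v) z ≈ dot u (take m z) + dot v (drop m z)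
  dot-++ {m} u v z = trans (sum-take-drop m _)
    (+-cong (dot-cong (take-++ u v) (λ _ → refl)) (dot-cong (drop-++ u v) (λ _ → refl)))

  Polyhedron-resp-≈ᵛ : ∀ {m n} (A : Matrix m n) (a : Vector Carrier m) {x x′} →
                       x ≈ᵛ x′ → x ∈ Polyhedron A a → x′ ∈ Polyhedron A a
  Polyhedron-resp-≈ᵛ A a x≈x′ x∈P i = ≤-cong (dot-cong (λ _ → refl) x≈x′) refl (x∈P i)

  -- All three senses follow from soundness and completeness of the `x`-coordinates, the linear map
  -- being the coordinate projection `take p`. Closure of `X` under `≈ᵛ` enters because vectors are
  -- functions: `take p (x ++ w)` agrees with `x` only entry by entry.
  isExtendedFormulation :
    ∀ {p q} (S : System p q) {X : Pred (Vector Carrier p) ℓ₂} →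
    (∀ {x x′} → x ≈ᵛ x′ → x ∈ X → x′ ∈ X) →
    (∀ z → z ∈ Solutions S → take p z ∈ X) →
    (∀ x → x ∈ X → Σ (Vector Carrier q) λ w → (x ++ w) ∈ Solutions S) →
    ∀ d → IsExtendedFormulation S X d
  isExtendedFormulation {p} {q} S {X} resp sound complete′ = λ where
      projection  → byProjection ((λ {x} → restrict x) , (λ {x} → complete′ x))
      linearImage → byLinearImage (take p) take-isLinear
        ( (λ {x} x∈X → let w , xw∈U = complete′ x x∈X in x ++ w , xw∈U , take-++ x w)
        , (λ (z , z∈U , z≈x) → resp z≈x (sound z z∈U)))
      membership  → byMembership (λ x → mk⇔ (complete′ x) (restrict x))
    where
    restrict : ∀ x → (Σ (Vector Carrier q) λ w → (x ++ w) ∈ Solutions S) → x ∈ X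
    restrict x (w , xw∈U) = resp (take-++ x w) (sound (x ++ w) xw∈U)

    take-isLinear : IsLinear (take p)
    take-isLinear = record
      { +ᴹ-isGroupHomomorphism = record
        { isMonoidHomomorphism = record
          { isMagmaHomomorphism = record
            { isRelHomomorphism = record { cong = λ z≈z′ i → z≈z′ (i ↑ˡ q) }
            ; homo = λ _ _ _ → refl
            }
          ; ε-homo = λ _ → refl
          }
        ; ⁻¹-homo = λ _ _ → refl
        }
      ; *ₗ-homo = λ _ _ _ → refl
      }

  module Product {p₁ n₁ p₂ n₂} (A₁ : Matrix p₁ n₁) (a₁ : Vector Carrier p₁)
                 (A₂ : Matrix p₂ n₂) (a₂ : Vector Carrier p₂) where

    system : GroupedSystem n₁ n₂ 0
    system = record
      { B = A₁ ++ replicate p₂ (replicate n₁ 0#)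
      ; C = replicate p₁ (replicate n₂ 0#) ++ A₂
      ; D = λ _ ()
      ; g = a₁ ++ a₂
      }

    open GroupedSystem system

    -- A form of the system independent of how its variables are grouped, so that the facts about P₁
    -- × P₂ need no concatenated vectors.
    Feasible : Vector Carrier n₁ → Vector Carrier n₂ → Set ℓ₂
    Feasible y x = B · y +ᵛ C · x ≤ᵛ g

    feasible⁺ : ∀ {y x} → y ∈ Polyhedron A₁ a₁ → x ∈ Polyhedron A₂ a₂ → Feasible y x
    -- Splitting the row index makes the stacked blocks compute: an upper row has zero coefficients
    -- on `x`, a lower row on `y`.
    feasible⁺ {y} {x} y∈P₁ x∈P₂ i with splitAt p₁ i
    ... | inj₁ r = ≤-cong (sym (trans (+-congˡ (dot-zeroˡ x)) (+-identityʳ _))) refl (y∈P₁ r)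
    ... | inj₂ r = ≤-cong (sym (trans (+-congʳ (dot-zeroˡ y)) (+-identityˡ _))) refl (x∈P₂ r)

    feasible⁻ : ∀ {y x} → Feasible y x → x ∈ Polyhedron A₂ a₂
    feasible⁻ {y} {x} yx r = ≤-cong lhs (reflexive (lookup-++ʳ a₁ a₂ r)) (yx (p₁ ↑ʳ r))
      where
      lhs : (B · y) (p₁ ↑ʳ r) + (C · x) (p₁ ↑ʳ r) ≈ (A₂ · x) r
      lhs = begin
        dot (B (p₁ ↑ʳ r)) y + dot (C (p₁ ↑ʳ r)) x
          ≡⟨ ≡.cong₂ (λ b c → dot b y + dot c x) (lookup-++ʳ A₁ _ r)
                     (lookup-++ʳ (replicate p₁ (replicate n₂ 0#)) A₂ r) ⟩
        dot (replicate n₁ 0#) y + dot (A₂ r) x  ≈⟨ +-congʳ (dot-zeroˡ y) ⟩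
        0# + dot (A₂ r) x                       ≈⟨ +-identityˡ _ ⟩
        dot (A₂ r) x                            ∎

    -- The third group of variables is empty, so its share of the product is the empty sum, which
    -- reduces to `0#`.
    dot-++-[] : ∀ {n} (u : Vector Carrier n) (v : Vector Carrier 0) (z : Vector Carrier (n ℕ.+ 0)) →
                dot (u ++ v) z ≈ dot u (take n z)
    dot-++-[] u v z = trans (dot-++ u v z) (+-identityʳ _)

    firstSolution : ∀ {y x} → Feasible y x → (y ++ (x ++ λ ())) ∈ Solutions firstGroup
    firstSolution {y} {x} yx i = ≤-cong (+-cong
      (dot-cong (λ _ → refl) (λ j → sym (take-++ y _ j)))
      (sym (trans (dot-++-[] (C i) _ _)
        (dot-cong (λ _ → refl) (λ j → trans (drop-++ y _ (j ↑ˡ 0)) (take-++ x _ j))))))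
      refl (yx i)

    secondSolution : ∀ {y x} → Feasible y x → (x ++ (y ++ λ ())) ∈ Solutions secondGroup
    -- `secondGroup` puts the `x`-block first, hence the commutation of the two summands.
    secondSolution {y} {x} yx i = ≤-cong (trans (+-comm _ _) (+-cong
      (dot-cong (λ _ → refl) (λ j → sym (take-++ x _ j)))
      (sym (trans (dot-++-[] (B i) _ _)
        (dot-cong (λ _ → refl) (λ j → trans (drop-++ x _ (j ↑ˡ 0)) (take-++ y _ j)))))))
      refl (yx i)

    secondSolution⁻ : ∀ z → z ∈ Solutions secondGroup →
                      Feasible (take n₁ (drop n₂ z)) (take n₂ z)
    secondSolution⁻ z z∈U i =
      ≤-cong (trans (+-comm _ _) (+-congʳ (dot-++-[] (B i) _ _))) refl (z∈U i)

    firstGroup-isAugmentation : Satisfiable (Polyhedron A₂ a₂) → IsAugmentation A₁ a₁ firstGroup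
    firstGroup-isAugmentation (x , x∈P₂) = record
      { contains = λ i → i ↑ˡ p₂ , 1# , 0<1
          , (λ j → trans (reflexive (≡.cong (λ b → b j) (lookup-++ˡ A₁ _ i))) (sym (*-identityˡ _)))
          , zeroCoefficients i
          , trans (reflexive (lookup-++ˡ a₁ a₂ i)) (sym (*-identityˡ _))
      -- The same point of P₂ serves for every `y`.
      ; redundant = λ y y∈P₁ → (x ++ λ ()) , firstSolution (feasible⁺ y∈P₁ x∈P₂)
      }
      where
      zeroCoefficients : ∀ i → System.H firstGroup (i ↑ˡ p₂) ≈ᵛ replicate (n₂ ℕ.+ 0) 0#
      zeroCoefficients i l with splitAt n₂ l
      -- The other case would be an index into the empty third group.
      ... | inj₁ k = reflexive (≡.cong (λ b → b k) (lookup-++ˡ (replicate p₁ (replicate n₂ 0#)) A₂ i))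

    augmentableInto : Satisfiable (Polyhedron A₁ a₁) → Satisfiable (Polyhedron A₂ a₂) →
                      ∀ d → AugmentableInto d A₁ a₁ (Polyhedron A₂ a₂)
    augmentableInto (y , y∈P₁) P₂≠∅ d = 0 , system , firstGroup-isAugmentation P₂≠∅ ,
      isExtendedFormulation secondGroup (Polyhedron-resp-≈ᵛ A₂ a₂)
        (λ z → feasible⁻ ∘ secondSolution⁻ z)
        -- The chosen point of P₁ completes every `x`, so no point of P₂ is lost in the projection.
        (λ x x∈P₂ → (y ++ λ ()) , secondSolution (feasible⁺ y∈P₁ x∈P₂)) d

theorem7 : ∀ {c ℓ₁ ℓ₂} (ℝ : RealNumbers c ℓ₁ ℓ₂) →
    let open RealNumbers ℝ using (Carrier)
        open Polyhedra ℝ in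
    (d : Sense) (n₁ n₂ p₁ p₂ : ℕ) → .{{NonZero n₁}} → .{{NonZero n₂}} →
    (A₁ : Matrix p₁ n₁) (a₁ : Vector Carrier p₁) →
    (A₂ : Matrix p₂ n₂) (a₂ : Vector Carrier p₂) →
    IsBounded (Polyhedron A₁ a₁) → Satisfiable (Polyhedron A₁ a₁) →
    IsBounded (Polyhedron A₂ a₂) → Satisfiable (Polyhedron A₂ a₂) →
    AugmentableInto d A₁ a₁ (Polyhedron A₂ a₂) ×
    AugmentableInto d A₂ a₂ (Polyhedron A₁ a₁)
theorem7 ℝ d _ _ _ _ A₁ a₁ A₂ a₂ _ P₁≠∅ _ P₂≠∅ =
  Product.augmentableInto ℝ A₁ a₁ A₂ a₂ P₁≠∅ P₂≠∅ d ,
  Product.augmentableInto ℝ A₂ a₂ A₁ a₁ P₂≠∅ P₁≠∅ d
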